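{- There exists an algorithm that, given an instance of \textsc{Set Radius Strip Cover} with $n$ sensors, computes an optimal radial assignment (one maximizing the lifetime) in $O(n^2\log n)$ time.
   Context: \textsc{Set Radius Strip Cover} (RadSC): An instance is a pair $(x,b)$, where $x=(x_1,\ldots,x_n)\in[0,1]^n$ with $x_1\le\cdots\le x_n$ are sensor locations and $b=(b_1,\ldots,b_n)$, $b_i\ge0$ rational, are battery charges. A solution is a radial assignment $\rho\in[0,\infty)^n$; all sensors are activated at time $0$. Sensor $i$ with $\rho_i>0$ covers $[x_i-\rho_i,x_i+\rho_i]$ during the time interval $[0,b_i/\rho_i]$; a sensor with $\rho_i=0$ is inactive and covers nothing. The lifetime of $\rho$ is the maximum $T$ such that for every $t\in[0,T]$, $[0,1]\subseteq\bigcup_{i:\rho_i>0,\ b_i/\rho_i\ge t}[x_i-\rho_i,x_i+\rho_i]$. The goal is to maximize the lifetime. -}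

module Defs where

open import Algebra.Bundles using (CommutativeRing)
open import Algebra.Structures using (IsCommutativeRing)
import Algebra.Definitions.RawMonoid as RawMonoidDefinitions
open import Data.Bool using (Bool; true; false; if_then_else_)
open import Data.Fin as Fin using (Fin; toℕ; fromℕ<)
open import Data.Maybe using (Maybe; just; nothing)
import Data.Maybe as Maybe
open import Data.Nat as ℕ using (ℕ; suc)
open import Data.Product using (∃; ∃₂; _×_)
open import Level using (Level; _⊔_) renaming (suc to lsuc)
open import Relation.Binary using (Rel; IsDecTotalOrder)
import Relation.Binary.Construct.NonStrictToStrict as ToStrict
open import Relation.Binary.PropositionalEquality using (_≡_)
open import Relation.Nullary using (¬_; yes; no; does)

_∈O_ : (ℕ → ℕ) → (ℕ → ℕ) → Set
T ∈O f = ∃₂ λ C n₀ → ∀ n → n₀ ℕ.≤ n → T n ℕ.≤ C ℕ.* f n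

-- The reals enter only as an ordered field whose order can be decided (the
-- comparison test of a real RAM); ℚ and, classically, ℝ are such fields.
-- The value of 0# ⁻¹ is unspecified and is never used below.
record OrderedField (c ℓ₁ ℓ₂ : Level) : Set (lsuc (c ⊔ ℓ₁ ⊔ ℓ₂)) where
  infix  8 -_ _⁻¹
  infixl 7 _*_ _÷_
  infixl 6 _+_
  infix  4 _≈_ _≤_
  field
    Carrier           : Set c
    _≈_               : Rel Carrier ℓ₁
    _≤_               : Rel Carrier ℓ₂
    _+_ _*_           : Carrier → Carrier → Carrier
    -_ _⁻¹            : Carrier → Carrier
    0# 1#             : Carrier
    isCommutativeRing : IsCommutativeRing _≈_ _+_ _*_ -_ 0# 1#
    isDecTotalOrder   : IsDecTotalOrder _≈_ _≤_
    0≉1               : ¬ (0# ≈ 1#)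
    *-inverseʳ        : ∀ {x} → ¬ (x ≈ 0#) → x * x ⁻¹ ≈ 1#
    +-monoˡ-≤         : ∀ z {x y} → x ≤ y → x + z ≤ y + z
    *-nonNegative     : ∀ {x y} → 0# ≤ x → 0# ≤ y → 0# ≤ x * y

  commutativeRing : CommutativeRing c ℓ₁
  commutativeRing = record { isCommutativeRing = isCommutativeRing }

  open CommutativeRing commutativeRing public using (_-_; +-rawMonoid)
  open IsDecTotalOrder isDecTotalOrder public using (_≟_; _≤?_)
  open ToStrict _≈_ _≤_ public using (_<_)

  _÷_ : Carrier → Carrier → Carrier
  x ÷ y = x * y ⁻¹

  open RawMonoidDefinitions +-rawMonoid public using () renaming (_×_ to _·_)

  -- a = (p - q) / (1 + r)
  IsRational : Carrier → Set ℓ₁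
  IsRational a = ∃₂ λ p q → ∃ λ r → suc r · a ≈ p · 1# - q · 1#

module RadSC {c ℓ₁ ℓ₂} (F : OrderedField c ℓ₁ ℓ₂) where
  open OrderedField F

  record Instance (n : ℕ) : Set (c ⊔ ℓ₁ ⊔ ℓ₂) where
    field
      x          : Fin n → Carrier
      b          : Fin n → Carrier
      x-sorted   : ∀ {i j} → i Fin.≤ j → x i ≤ x j
      0≤x        : ∀ i → 0# ≤ x i
      x≤1        : ∀ i → x i ≤ 1#
      0≤b        : ∀ i → 0# ≤ b i
      b-rational : ∀ i → IsRational (b i)

  module _ {n : ℕ} (I : Instance n) where
    open Instance I

    IsRadialAssignment : (Fin n → Carrier) → Set ℓ₂
    IsRadialAssignment ρ = ∀ i → 0# ≤ ρ i

    CoversAt : (Fin n → Carrier) → Carrier → Fin n → Carrier → Set (ℓ₁ ⊔ ℓ₂)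
    CoversAt ρ t i y =
      0# < ρ i × t ≤ b i ÷ ρ i × x i - ρ i ≤ y × y ≤ x i + ρ i

    StripCoveredAt : (Fin n → Carrier) → Carrier → Set (c ⊔ ℓ₁ ⊔ ℓ₂)
    StripCoveredAt ρ t =
      ∀ y → 0# ≤ y → y ≤ 1# → ∃ λ i → CoversAt ρ t i y

    SurvivesUntil : (Fin n → Carrier) → Carrier → Set (c ⊔ ℓ₁ ⊔ ℓ₂)
    SurvivesUntil ρ T =
      0# ≤ T × (∀ t → 0# ≤ t → t ≤ T → StripCoveredAt ρ t)

    -- Relational, because an assignment that does not even cover the strip
    -- at time 0 has no lifetime.
    IsLifetime : (Fin n → Carrier) → Carrier → Set (c ⊔ ℓ₁ ⊔ ℓ₂)
    IsLifetime ρ T =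
      SurvivesUntil ρ T × (∀ T′ → SurvivesUntil ρ T′ → T′ ≤ T)

    IsOptimal : (Fin n → Carrier) → Set (c ⊔ ℓ₁ ⊔ ℓ₂)
    IsOptimal ρ =
      IsRadialAssignment ρ ×
      ∃ λ T → IsLifetime ρ T ×
        (∀ ρ′ T′ → IsRadialAssignment ρ′ → IsLifetime ρ′ T′ → T′ ≤ T)

-- A program mentions finitely many registers and arrays, so named arrays are
-- an interleaving of one memory.  Integers change by at most one per step,
-- hence after t steps they exceed neither the input size nor the program's
-- constants by more than t: unit cost does not hide work on long words.

Reg Arr : Set
Reg = ℕ
Arr = ℕ

infix 9 _[_]

-- an array name and the register holding the index
data Cell : Set where
  _[_] : Arr → Reg → Cell

infixl 6 _⊕_ _⊖_
infixl 7 _⊗_ _⊘_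

data RealExp : Set where
  𝟘 𝟙             : RealExp
  copy            : Cell → RealExp
  _⊕_ _⊖_ _⊗_ _⊘_ : Cell → Cell → RealExp

infix 5 _≔_ _≔ʳ_ _≔ᶜ_

data Instr : Set where
  _≔ᶜ_  : Reg → ℕ → Instr
  _≔ʳ_  : Reg → Reg → Instr
  inc   : Reg → Instr
  dec   : Reg → Instr
  load  : Reg → Cell → Instr
  store : Cell → Reg → Instr
  _≔_   : Cell → RealExp → Instr

data Test : Set where
  _≤ᴺ_ : Reg → Reg → Test
  _≤ᴿ_ : Cell → Cell → Test

infixr 4 _⨾_

data Program : Set where
  skip  : Program
  instr : Instr → Program
  _⨾_   : Program → Program → Program
  if    : Test → Program → Program → Program
  while : Test → Program → Program

update : ∀ {a} {A : Set a} → ℕ → A → (ℕ → A) → ℕ → A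
update k v f j = if j ℕ.≡ᵇ k then v else f j

module RealRAM {c ℓ₁ ℓ₂} (F : OrderedField c ℓ₁ ℓ₂) where
  open OrderedField F

  record State : Set c where
    constructor ⟪_,_,_⟫
    field
      regs  : Reg → ℕ
      ints  : Arr → ℕ → ℕ
      reals : Arr → ℕ → Carrier

    int : Cell → ℕ
    int (a [ r ]) = ints a (regs r)

    real : Cell → Carrier
    real (a [ r ]) = reals a (regs r)

  open State

  updateCell : ∀ {a} {A : Set a} → State → Cell → A →
               (Arr → ℕ → A) → Arr → ℕ → A
  updateCell σ (a [ r ]) v m = update a (update (regs σ r) v (m a)) m

  setReg : State → Reg → ℕ → State
  setReg σ r k = record σ { regs = update r k (regs σ) }

  eval : State → RealExp → Maybe Carrier
  eval σ 𝟘        = just 0#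
  eval σ 𝟙        = just 1#
  eval σ (copy u) = just (real σ u)
  eval σ (u ⊕ v)  = just (real σ u + real σ v)
  eval σ (u ⊖ v)  = just (real σ u - real σ v)
  eval σ (u ⊗ v)  = just (real σ u * real σ v)
  eval σ (u ⊘ v) with real σ v ≟ 0#
  ... | yes _ = nothing
  ... | no  _ = just (real σ u ÷ real σ v)

  exec : Instr → State → Maybe State
  exec (r ≔ᶜ k)    σ = just (setReg σ r k)
  exec (r ≔ʳ s)    σ = just (setReg σ r (regs σ s))
  exec (inc r)     σ = just (setReg σ r (suc (regs σ r)))
  exec (dec r)     σ = just (setReg σ r (ℕ.pred (regs σ r)))
  exec (load r u)  σ = just (setReg σ r (int σ u))
  exec (store u r) σ = just (record σ { ints = updateCell σ u (regs σ r) (ints σ) })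
  exec (u ≔ e)     σ =
    Maybe.map (λ v → record σ { reals = updateCell σ u v (reals σ) }) (eval σ e)

  test : Test → State → Bool
  test (r ≤ᴺ s) σ = does (regs σ r ℕ.≤? regs σ s)
  test (u ≤ᴿ v) σ = does (real σ u ≤? real σ v)

  -- P ⊢ σ ⇓ σ′ in-time t: started in σ, P halts in σ′ after t instructions
  -- and tests.
  infix 3 _⊢_⇓_in-time_

  data _⊢_⇓_in-time_ : Program → State → State → ℕ → Set c where
    ⇓-skip   : ∀ {σ} → skip ⊢ σ ⇓ σ in-time 0
    ⇓-instr  : ∀ {ι σ σ′} → exec ι σ ≡ just σ′ →
               instr ι ⊢ σ ⇓ σ′ in-time 1
    ⇓-seq    : ∀ {P Q σ σ′ σ″ t u} →
               P ⊢ σ ⇓ σ′ in-time t → Q ⊢ σ′ ⇓ σ″ in-time u →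
               P ⨾ Q ⊢ σ ⇓ σ″ in-time (t ℕ.+ u)
    ⇓-then   : ∀ {g P Q σ σ′ t} → test g σ ≡ true →
               P ⊢ σ ⇓ σ′ in-time t →
               if g P Q ⊢ σ ⇓ σ′ in-time (suc t)
    ⇓-else   : ∀ {g P Q σ σ′ t} → test g σ ≡ false →
               Q ⊢ σ ⇓ σ′ in-time t →
               if g P Q ⊢ σ ⇓ σ′ in-time (suc t)
    ⇓-exit   : ∀ {g P σ} → test g σ ≡ false →
               while g P ⊢ σ ⇓ σ in-time 1
    ⇓-repeat : ∀ {g P σ σ′ σ″ t u} → test g σ ≡ true →
               P ⊢ σ ⇓ σ′ in-time t → while g P ⊢ σ′ ⇓ σ″ in-time u →
               while g P ⊢ σ ⇓ σ″ in-time (suc (t ℕ.+ u))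

module RadSCAlgorithm {c ℓ₁ ℓ₂} (F : OrderedField c ℓ₁ ℓ₂) where
  open OrderedField F
  open RadSC F
  open RealRAM F

  padded : ∀ {n} → (Fin n → Carrier) → ℕ → Carrier
  padded {n} v k with k ℕ.<? n
  ... | yes k<n = v (fromℕ< k<n)
  ... | no  _   = 0#

  -- Input: n in register 0, x in array 0, b in array 1; all else is zero.
  input : ∀ {n} → Instance n → State
  input {n} I = ⟪ regs₀ , (λ _ _ → 0) , reals₀ ⟫
    where
    open Instance I
    regs₀ : Reg → ℕ
    regs₀ 0 = n
    regs₀ _ = 0
    reals₀ : Arr → ℕ → Carrier
    reals₀ 0 = padded x
    reals₀ 1 = padded b
    reals₀ _ = λ _ → 0#

  -- Output: ρ in array 2.
  output : ∀ {n} → State → Fin n → Carrier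
  output σ i = State.reals σ 2 (toℕ i)

  -- n = 0 is excluded: without sensors no assignment has a lifetime.
  SolvesRadSCWithin : Program → (ℕ → ℕ) → Set (c ⊔ ℓ₁ ⊔ ℓ₂)
  SolvesRadSCWithin P T =
    ∀ n .{{_ : ℕ.NonZero n}} (I : Instance n) →
    ∃₂ λ σ t → (P ⊢ input I ⇓ σ in-time t) × IsOptimal I (output σ) × t ℕ.≤ T n

-- A cover of the strip by disks [xᵢ − bᵢ r , xᵢ + bᵢ r] with bᵢ > 0 survives until
-- T = 1/r, and any assignment alive at time T > 0 has ρᵢ ≤ bᵢ/T on its active
-- sensors; so an optimal assignment is ρᵢ = bᵢ r for the least r for which these
-- disks cover.  They cover iff a chain of sensors i₁ < … < iₘ joins the two walls
-- with consecutive disks meeting, so r is a bottleneck path value, which the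
-- quadratic dynamic program
--   dⱼ = min (xⱼ/bⱼ , min_{i<j} max (dᵢ , (xⱼ − xᵢ)/(bᵢ + bⱼ)))
--   1/r = τ = maxⱼ 1 / max (dⱼ , (1 − xⱼ)/bⱼ)
-- computes.  A chain with increasing indices suffices: a last disk that ends
-- before the goal is contained in a disk of an earlier sensor and can be dropped.
module Submission where

open import Algebra.Bundles using (CommutativeRing)
import Algebra.Solver.Ring.NaturalCoefficients.Default as SemiringSolver
open import Data.Bool using (true; false)
open import Data.Bool.Properties using (T-≡)
open import Data.Fin using (Fin; toℕ; fromℕ<)
open import Data.Fin.Properties using (toℕ<n; fromℕ<-toℕ; toℕ-fromℕ<)
open import Data.Maybe using (just)
open import Data.Nat as ℕ using (ℕ; zero; suc; z≤n; s≤s)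
open import Data.Nat.Logarithm using (⌊log₂_⌋; ⌊log₂⌋-mono-≤)
import Data.Nat.Properties as ℕₚ
open import Data.Product using (∃; ∃₂; _×_; _,_; proj₁; proj₂)
open import Data.Sum using (_⊎_; inj₁; inj₂; [_,_]′)
open import Data.Unit.Polymorphic using (⊤; tt)
open import Defs
open import Function using (_∘_; _$_; id; _⇔_; mk⇔; Equivalence)
open import Level using (Level; _⊔_)
open import Relation.Binary.Bundles using (DecTotalOrder)
import Relation.Binary.Properties.Poset as PosetProperties
import Relation.Binary.Properties.TotalOrder as TotalOrderProperties
open import Relation.Binary.PropositionalEquality as ≡ using (_≡_)
import Relation.Binary.Reasoning.PartialOrder as ≤-Reasoning
open import Relation.Nullary using (¬_; yes; no; does; contradiction)
open import Relation.Nullary.Decidable using (dec-true; dec-false)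

open Equivalence using (to; from)

-- Order and division in an ordered field.

module OrderedFieldProperties {c ℓ₁ ℓ₂} (F : OrderedField c ℓ₁ ℓ₂) where
  open OrderedField F
  open CommutativeRing commutativeRing public
    using (+-cong; +-congˡ; *-congˡ; *-congʳ;
           +-assoc; +-comm; +-identityˡ; +-identityʳ; -‿inverseˡ; -‿inverseʳ;
           *-assoc; *-comm; *-identityˡ; *-identityʳ; zeroˡ;
           distribˡ; distribʳ; commutativeSemiring; ring)
  open import Algebra.Properties.Ring ring
    using (-1*x≈-x; -‿involutive)

  decTotalOrder : DecTotalOrder c ℓ₁ ℓ₂
  decTotalOrder = record { isDecTotalOrder = isDecTotalOrder }

  open DecTotalOrder decTotalOrder public
    using (totalOrder; poset; antisym; module Eq)
    renaming (refl to ≤-refl; reflexive to ≤-reflexive; trans to ≤-trans)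
  open Eq public using () renaming (refl to ≈-refl; sym to ≈-sym; trans to ≈-trans)
  open PosetProperties poset public using (<⇒≱)
  open TotalOrderProperties totalOrder public using (≰⇒>; ≰⇒≥)
  open ≤-Reasoning poset

  ÷-cancelʳ : ∀ {x y} → ¬ y ≈ 0# → x ÷ y * y ≈ x
  ÷-cancelʳ {x} {y} y≉0 = begin-equality
    x * y ⁻¹ * y    ≈⟨ *-assoc x (y ⁻¹) y ⟩
    x * (y ⁻¹ * y)  ≈⟨ *-congˡ (≈-trans (*-comm (y ⁻¹) y) (*-inverseʳ y≉0)) ⟩
    x * 1#          ≈⟨ *-identityʳ x ⟩
    x               ∎

  +-monoʳ-≤ : ∀ z {x y} → x ≤ y → z + x ≤ z + y
  +-monoʳ-≤ z {x} {y} x≤y = begin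
    z + x  ≈⟨ +-comm z x ⟩
    x + z  ≤⟨ +-monoˡ-≤ z x≤y ⟩
    y + z  ≈⟨ +-comm y z ⟩
    z + y  ∎

  +-mono-≤ : ∀ {w x y z} → w ≤ x → y ≤ z → w + y ≤ x + z
  +-mono-≤ {x = x} {y = y} w≤x y≤z = ≤-trans (+-monoˡ-≤ y w≤x) (+-monoʳ-≤ x y≤z)

  +-cancelʳ-≤ : ∀ z {x y} → x + z ≤ y + z → x ≤ y
  +-cancelʳ-≤ z {x} {y} x+z≤y+z = begin
    x              ≈⟨ +-inverseʳ x ⟨
    x + z + - z    ≤⟨ +-monoˡ-≤ (- z) x+z≤y+z ⟩
    y + z + - z    ≈⟨ +-inverseʳ y ⟩
    y              ∎
    where
    +-inverseʳ : ∀ w → w + z + - z ≈ w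
    +-inverseʳ w = begin-equality
      w + z + - z    ≈⟨ +-assoc w z (- z) ⟩
      w + (z + - z)  ≈⟨ +-congˡ (-‿inverseʳ z) ⟩
      w + 0#         ≈⟨ +-identityʳ w ⟩
      w              ∎

  x-y+y≈x : ∀ x y → x - y + y ≈ x
  x-y+y≈x x y = begin-equality
    x + - y + y    ≈⟨ +-assoc x (- y) y ⟩
    x + (- y + y)  ≈⟨ +-congˡ (-‿inverseˡ y) ⟩
    x + 0#         ≈⟨ +-identityʳ x ⟩
    x              ∎

  x-y≤z⇔x≤y+z : ∀ {x y z} → (x - y ≤ z) ⇔ (x ≤ y + z)
  x-y≤z⇔x≤y+z {x} {y} {z} = mk⇔
    (λ x-y≤z → begin
      x          ≈⟨ x-y+y≈x x y ⟨
      x - y + y  ≤⟨ +-monoˡ-≤ y x-y≤z ⟩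
      z + y      ≈⟨ +-comm z y ⟩
      y + z      ∎)
    (λ x≤y+z → +-cancelʳ-≤ y (begin
      x - y + y  ≈⟨ x-y+y≈x x y ⟩
      x          ≤⟨ x≤y+z ⟩
      y + z      ≈⟨ +-comm y z ⟩
      z + y      ∎))

  x≤y⇒0≤y-x : ∀ {x y} → x ≤ y → 0# ≤ y - x
  x≤y⇒0≤y-x {x} {y} x≤y = begin
    0#     ≈⟨ -‿inverseʳ x ⟨
    x - x  ≤⟨ +-monoˡ-≤ (- x) x≤y ⟩
    y - x  ∎

  *-monoʳ-≤ : ∀ {z} → 0# ≤ z → ∀ {x y} → x ≤ y → x * z ≤ y * z
  *-monoʳ-≤ {z} 0≤z {x} {y} x≤y = begin
    x * z                        ≈⟨ +-identityˡ (x * z) ⟨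
    0# + x * z                   ≤⟨ +-monoˡ-≤ (x * z) (*-nonNegative (x≤y⇒0≤y-x x≤y) 0≤z) ⟩
    (y - x) * z + x * z          ≈⟨ distribʳ z (y - x) x ⟨
    (y - x + x) * z              ≈⟨ *-congʳ (x-y+y≈x y x) ⟩
    y * z                        ∎

  -- If `x ≰ y`, then `y ≤ x`, so monotonicity forces the two products to be equal; multiplying by
  -- `z ⁻¹` gives `x ≈ y`. The sign of `z ⁻¹` does not enter here; `0<x⁻¹` settles it later.
  *-cancelʳ-≤ : ∀ {z} → 0# < z → ∀ {x y} → x * z ≤ y * z → x ≤ y
  *-cancelʳ-≤ {z} (0≤z , 0≉z) {x} {y} xz≤yz with x ≤? y
  ... | yes x≤y = x≤y
  ... | no  x≰y = ≤-reflexive (begin-equality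
    x                ≈⟨ *-inverse x ⟨
    x * z * z ⁻¹     ≈⟨ *-congʳ (antisym xz≤yz (*-monoʳ-≤ 0≤z (≰⇒≥ x≰y))) ⟩
    y * z * z ⁻¹     ≈⟨ *-inverse y ⟩
    y                ∎)
    where
    *-inverse : ∀ w → w * z * z ⁻¹ ≈ w
    *-inverse w = begin-equality
      w * z * z ⁻¹    ≈⟨ *-assoc w z (z ⁻¹) ⟩
      w * (z * z ⁻¹)  ≈⟨ *-congˡ (*-inverseʳ (0≉z ∘ ≈-sym)) ⟩
      w * 1#          ≈⟨ *-identityʳ w ⟩
      w               ∎

  <⇒≉0 : ∀ {x} → 0# < x → ¬ x ≈ 0#
  <⇒≉0 (_ , 0≉x) x≈0 = 0≉x (≈-sym x≈0)

  <-≤-trans : ∀ {x y z} → x < y → y ≤ z → x < z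
  <-≤-trans x<y y≤z = ≤-trans (proj₁ x<y) y≤z ,
    λ x≈z → <⇒≱ x<y (≤-trans y≤z (≤-reflexive (≈-sym x≈z)))

  -- Were `1# ≤ 0#`, then `- 1#` would be non-negative, and so would its square `1#`.
  0<1 : 0# < 1#
  0<1 = ≰⇒> λ 1≤0 → 0≉1 (antisym (begin
    0#              ≤⟨ *-nonNegative (0≤-1 1≤0) (0≤-1 1≤0) ⟩
    - 1# * - 1#     ≈⟨ -1*x≈-x (- 1#) ⟩
    - (- 1#)        ≈⟨ -‿involutive 1# ⟩
    1#              ∎) 1≤0)
    where
    0≤-1 : 1# ≤ 0# → 0# ≤ - 1#
    0≤-1 1≤0 = ≤-trans (x≤y⇒0≤y-x 1≤0) (≤-reflexive (+-identityˡ (- 1#)))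

  0<x*y : ∀ {x y} → 0# < x → 0# < y → 0# < x * y
  0<x*y {x} {y} 0<x 0<y = ≰⇒> λ xy≤0 → <⇒≱ 0<x
    (*-cancelʳ-≤ 0<y (≤-trans xy≤0 (≤-reflexive (≈-sym (zeroˡ y)))))

  0<x⁻¹ : ∀ {x} → 0# < x → 0# < x ⁻¹
  0<x⁻¹ {x} 0<x = ≰⇒> λ x⁻¹≤0 → <⇒≱ 0<1 (begin
    1#          ≈⟨ *-inverseʳ (<⇒≉0 0<x) ⟨
    x * x ⁻¹    ≈⟨ *-comm x (x ⁻¹) ⟩
    x ⁻¹ * x    ≤⟨ *-monoʳ-≤ (proj₁ 0<x) x⁻¹≤0 ⟩
    0# * x      ≈⟨ zeroˡ x ⟩
    0#          ∎)

  0<x+y : ∀ {x y} → 0# < x → 0# < y → 0# < x + y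
  0<x+y {x} {y} 0<x 0<y = <-≤-trans 0<x (begin
    x       ≈⟨ +-identityʳ x ⟨
    x + 0#  ≤⟨ +-monoʳ-≤ x (proj₁ 0<y) ⟩
    x + y   ∎)

  x÷y≤z⇔x≤y*z : ∀ {x y z} → 0# < y → (x ÷ y ≤ z) ⇔ (x ≤ y * z)
  x÷y≤z⇔x≤y*z {x} {y} {z} 0<y = mk⇔
    (λ x÷y≤z → begin
      x          ≈⟨ ÷-cancelʳ (<⇒≉0 0<y) ⟨
      x ÷ y * y  ≤⟨ *-monoʳ-≤ (proj₁ 0<y) x÷y≤z ⟩
      z * y      ≈⟨ *-comm z y ⟩
      y * z      ∎)
    (λ x≤y*z → *-cancelʳ-≤ 0<y (begin
      x ÷ y * y  ≈⟨ ÷-cancelʳ (<⇒≉0 0<y) ⟩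
      x          ≤⟨ x≤y*z ⟩
      y * z      ≈⟨ *-comm y z ⟩
      z * y      ∎))

  z≤x÷y⇔z*y≤x : ∀ {x y z} → 0# < y → (z ≤ x ÷ y) ⇔ (z * y ≤ x)
  z≤x÷y⇔z*y≤x {x} {y} {z} 0<y = mk⇔
    (λ z≤x÷y → ≤-trans (*-monoʳ-≤ (proj₁ 0<y) z≤x÷y) (≤-reflexive (÷-cancelʳ (<⇒≉0 0<y))))
    (λ z*y≤x → *-cancelʳ-≤ 0<y (≤-trans z*y≤x (≤-reflexive (≈-sym (÷-cancelʳ (<⇒≉0 0<y))))))

  x*y≤0 : ∀ {x y} → 0# < x → y ≤ 0# → x * y ≤ 0#
  x*y≤0 {x} {y} 0<x y≤0 = begin
    x * y   ≈⟨ *-comm x y ⟩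
    y * x   ≤⟨ *-monoʳ-≤ (proj₁ 0<x) y≤0 ⟩
    0# * x  ≈⟨ zeroˡ x ⟩
    0#      ∎

  -- Serves `Covered⇒Reach`, which needs a point strictly between the right end of a disk and the
  -- open end of an interval. The witness is the midpoint.
  <-dense : ∀ {x y} → x < y → ∃ λ z → x < z × z < y
  <-dense {x} {y} x<y = z ,
    ≰⇒> (λ z≤x → <⇒≱ x<y (+-cancelʳ-≤ x (begin
      y + x        ≈⟨ +-comm y x ⟩
      x + y        ≈⟨ z*2≈x+y ⟨
      z * 2#       ≤⟨ *-monoʳ-≤ (proj₁ 0<2) z≤x ⟩
      x * 2#       ≈⟨ w*2≈w+w x ⟩
      x + x        ∎))) ,
    ≰⇒> (λ y≤z → <⇒≱ x<y (+-cancelʳ-≤ y (begin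
      y + y        ≈⟨ w*2≈w+w y ⟨
      y * 2#       ≤⟨ *-monoʳ-≤ (proj₁ 0<2) y≤z ⟩
      z * 2#       ≈⟨ z*2≈x+y ⟩
      x + y        ∎)))
    where
    2# z : Carrier
    2# = 1# + 1#
    z = (x + y) ÷ 2#
    0<2 : 0# < 2#
    0<2 = 0<x+y 0<1 0<1
    z*2≈x+y : z * 2# ≈ x + y
    z*2≈x+y = ÷-cancelʳ (<⇒≉0 0<2)
    w*2≈w+w : ∀ w → w * 2# ≈ w + w
    w*2≈w+w w = ≈-trans (distribˡ w 1# 1#) (+-cong (*-identityʳ w) (*-identityʳ w))

-- Covers of the strip by disks versus chains of sensors.

module StripCover {c ℓ₁ ℓ₂} (F : OrderedField c ℓ₁ ℓ₂) where
  open OrderedField F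
  open OrderedFieldProperties F
  open SemiringSolver commutativeSemiring using (solve; _:=_; _:+_; _:*_)
  open ≤-Reasoning poset

  module _ (X B : ℕ → Carrier) where

    infix 4 _∈Disk⟨_,_⟩

    -- The left end is expressed without subtraction, which keeps the inequalities within reach of
    -- the semiring solver.
    _∈Disk⟨_,_⟩ : Carrier → ℕ → Carrier → Set ℓ₂
    y ∈Disk⟨ i , r ⟩ = X i ≤ y + B i * r × y ≤ X i + B i * r

    -- Chains from the wall at 0 to sensor `j`. The last premise of `link` says that the left end of
    -- disk `j` does not lie beyond the right end of disk `i`. No sign is imposed on `r`, so the
    -- thresholds of the dynamic program can be characterised for every `r`.
    data Reach (r : Carrier) : ℕ → Set (ℓ₁ ⊔ ℓ₂) where
      base : ∀ {j} → 0# < B j → X j ≤ B j * r → Reach r j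
      link  : ∀ {i j} → Reach r i → 0# < B j → i ℕ.< j →
              X j ≤ X i + (B i + B j) * r → Reach r j

    Crossing : Carrier → ℕ → Set (ℓ₁ ⊔ ℓ₂)
    Crossing r n = ∃ λ j → j ℕ.< n × Reach r j × 1# ≤ X j + B j * r

    Covered : Carrier → ℕ → Carrier → Set (ℓ₁ ⊔ ℓ₂)
    Covered r n y = ∃ λ i → i ℕ.< n × 0# < B i × y ∈Disk⟨ i , r ⟩

    Reach⇒0<B : ∀ {r j} → Reach r j → 0# < B j
    Reach⇒0<B (base 0<B _)    = 0<B
    Reach⇒0<B (link _ 0<B _ _) = 0<B

    -- Walk back along the chain. A point within the right end of the predecessor is handled by the
    -- shorter chain; any other point lies beyond that end, hence beyond the left end of disk `j`,
    -- because consecutive disks meet.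
    Reach⇒Covered : ∀ {r n j y} → j ℕ.< n → Reach r j →
                    0# ≤ y → y ≤ X j + B j * r → Covered r n y
    Reach⇒Covered {r} {j = j} {y} j<n (base 0<B X≤Br) 0≤y y≤right =
      j , j<n , 0<B , (begin
        X j          ≤⟨ X≤Br ⟩
        B j * r      ≈⟨ +-identityˡ (B j * r) ⟨
        0# + B j * r ≤⟨ +-monoˡ-≤ (B j * r) 0≤y ⟩
        y + B j * r  ∎) , y≤right
    Reach⇒Covered {r} {j = j} {y} j<n (link {i} reach 0<B i<j Xj≤) 0≤y y≤right
      with y ≤? X i + B i * r
    ... | yes y≤ = Reach⇒Covered (ℕₚ.<-trans i<j j<n) reach 0≤y y≤
    ... | no  y≰ = j , j<n , 0<B , (begin
        X j                        ≤⟨ Xj≤ ⟩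
        X i + (B i + B j) * r      ≈⟨ solve 4 (λ x b b′ r → x :+ (b :+ b′) :* r := x :+ b :* r :+ b′ :* r)
                                      ≈-refl (X i) (B i) (B j) r ⟩
        X i + B i * r + B j * r    ≤⟨ +-monoˡ-≤ (B j * r) (≰⇒≥ y≰) ⟩
        y + B j * r                ∎) , y≤right

    Crossing⇒Covered : ∀ {r n y} → Crossing r n → 0# ≤ y → y ≤ 1# → Covered r n y
    Crossing⇒Covered (j , j<n , reach , 1≤right) 0≤y y≤1 =
      Reach⇒Covered j<n reach 0≤y (≤-trans y≤1 1≤right)

    Reach⇒X≤0 : ∀ {r j} → r ≤ 0# → Reach r j → X j ≤ 0#
    Reach⇒X≤0 r≤0 (base 0<B X≤Br) = ≤-trans X≤Br (x*y≤0 0<B r≤0)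
    Reach⇒X≤0 {r} r≤0 (link {i} {j} reach 0<B i<j Xj≤) = begin
      X j                     ≤⟨ Xj≤ ⟩
      X i + (B i + B j) * r   ≤⟨ +-mono-≤ (Reach⇒X≤0 r≤0 reach) (x*y≤0 (0<x+y (Reach⇒0<B reach) 0<B) r≤0) ⟩
      0# + 0#                 ≈⟨ +-identityˡ 0# ⟩
      0#                      ∎

    -- With `r ≤ 0#` the right end of the last disk of a chain never passes 0, let alone 1. This
    -- positivity is what makes the division by `w` in `finish` defined.
    1≤right⇒0<r : ∀ {r j} → Reach r j → 1# ≤ X j + B j * r → 0# < r
    1≤right⇒0<r {r} {j} reach 1≤right = ≰⇒> λ r≤0 → <⇒≱ 0<1 (begin
      1#             ≤⟨ 1≤right ⟩
      X j + B j * r  ≤⟨ +-mono-≤ (Reach⇒X≤0 r≤0 reach) (x*y≤0 (Reach⇒0<B reach) r≤0) ⟩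
      0# + 0#        ≈⟨ +-identityˡ 0# ⟩
      0#             ∎)

    module _ {n} (sorted : ∀ {i j} → i ℕ.≤ j → j ℕ.< n → X i ≤ X j)
             (0≤X : ∀ {i} → i ℕ.< n → 0# ≤ X i) {r} (0≤r : 0# ≤ r) where

      -- Disk `i` is centred no further right than disk `k` and yet reaches at least as far right,
      -- so its radius is at least as large and its left end lies no further right.
      Disk-⊆ : ∀ {i k y z} → i ℕ.< k → k ℕ.< n → X k + B k * r ≤ z → z ∈Disk⟨ i , r ⟩ →
               y ∈Disk⟨ k , r ⟩ → y ∈Disk⟨ i , r ⟩
      Disk-⊆ {i} {k} {y} {z} i<k k<n right≤z (_ , z≤right) (Xk≤ , y≤right) =
        (begin
          X i            ≤⟨ Xi≤Xk ⟩
          X k            ≤⟨ Xk≤ ⟩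
          y + B k * r    ≤⟨ +-monoʳ-≤ y Bkr≤Bir ⟩
          y + B i * r    ∎) , ≤-trans y≤right rightk≤righti
        where
        Xi≤Xk : X i ≤ X k
        Xi≤Xk = sorted (ℕₚ.<⇒≤ i<k) k<n
        rightk≤righti : X k + B k * r ≤ X i + B i * r
        rightk≤righti = ≤-trans right≤z z≤right
        Bkr≤Bir : B k * r ≤ B i * r
        Bkr≤Bir = +-cancelʳ-≤ (X k) (begin
          B k * r + X k  ≈⟨ +-comm (B k * r) (X k) ⟩
          X k + B k * r  ≤⟨ rightk≤righti ⟩
          X i + B i * r  ≤⟨ +-monoˡ-≤ (B i * r) Xi≤Xk ⟩
          X k + B i * r  ≈⟨ +-comm (X k) (B i * r) ⟩
          B i * r + X k  ∎)

      -- The half-open [0 , z) lets the induction remove the closed disk of the last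
      -- sensor and still be left with an interval of the same kind.
      Covered⇒Reach : ∀ k → k ℕ.≤ n → ∀ {z} → 0# < z →
                      (∀ y → 0# ≤ y → y < z → Covered r k y) →
                      ∃ λ j → j ℕ.< k × Reach r j × z ≤ X j + B j * r
      Covered⇒Reach zero _ 0<z cover with cover 0# ≤-refl 0<z
      ... | _ , () , _
      Covered⇒Reach (suc k) k<n {z} 0<z cover = cases
        where
        0≤Xk : 0# ≤ X k
        0≤Xk = 0≤X k<n
        Goal : Carrier → ℕ → Set _
        Goal z m = ∃ λ j → j ℕ.< m × Reach r j × z ≤ X j + B j * r
        weaken : ∀ {z} → Goal z k → Goal z (suc k)
        weaken (j , j<k , rest) = j , ℕₚ.m<n⇒m<1+n j<k , rest
        without-k : ∀ {z′} → 0# < z′ → z′ ≤ z →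
                    (∀ {y} → y < z′ → 0# < B k → y ∈Disk⟨ k , r ⟩ → Covered r k y) → Goal z′ k
        without-k {z′} 0<z′ z′≤z reroute = Covered⇒Reach k (ℕₚ.<⇒≤ k<n) 0<z′ cover′
          where
          cover′ : ∀ y → 0# ≤ y → y < z′ → Covered r k y
          cover′ y 0≤y y<z′ with cover y 0≤y (<-≤-trans y<z′ z′≤z)
          ... | i , i<1+k , 0<Bi , y∈i with ℕₚ.m<1+n⇒m<n∨m≡n i<1+k
          ...   | inj₁ i<k    = i , i<k , 0<Bi , y∈i
          ...   | inj₂ ≡.refl = reroute y<z′ 0<Bi y∈i
        cases : Goal z (suc k)
        cases with B k ≤? 0#
        ... | yes Bk≤0 = weaken (without-k 0<z ≤-refl λ _ 0<Bk _ → contradiction Bk≤0 (<⇒≱ 0<Bk))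
        ... | no  Bk≰0 with z + B k * r ≤? X k
        ...   | yes z≤left = weaken (without-k 0<z ≤-refl λ y<z _ (left≤y , _) →
                  contradiction (+-cancelʳ-≤ (B k * r) (≤-trans z≤left left≤y)) (<⇒≱ y<z))
        ...   | no  z≰left with z ≤? X k + B k * r
        ...     | no z≰right = weaken (without-k 0<z ≤-refl reroute)
          where
          right<z = ≰⇒> z≰right
          reroute : ∀ {y} → y < z → 0# < B k → y ∈Disk⟨ k , r ⟩ → Covered r k y
          reroute y<z 0<Bk y∈k with <-dense right<z
          -- The point `w` lies beyond disk `k`, so an earlier disk covers it, and by `Disk-⊆` that
          -- disk contains all of disk `k`.
          ... | w , right<w , w<z with cover w 0≤w w<z
            where
            0≤w : 0# ≤ w
            0≤w = begin
              0#             ≈⟨ +-identityˡ 0# ⟨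
              0# + 0#        ≤⟨ +-mono-≤ 0≤Xk (*-nonNegative (proj₁ 0<Bk) 0≤r) ⟩
              X k + B k * r  ≤⟨ proj₁ right<w ⟩
              w              ∎
          ...   | i , i<1+k , 0<Bi , w∈i with ℕₚ.m<1+n⇒m<n∨m≡n i<1+k
          ...     | inj₁ i<k    = i , i<k , 0<Bi , Disk-⊆ i<k k<n (proj₁ right<w) w∈i y∈k
          ...     | inj₂ ≡.refl = contradiction (proj₂ w∈i) (<⇒≱ right<w)
        cases | no Bk≰0 | no z≰left | yes z≤right with X k ≤? B k * r
        ... | yes Xk≤ = k , ℕₚ.n<1+n k , base (≰⇒> Bk≰0) Xk≤ , z≤right
        -- Disk `k` reaches `z` but starts at `X k - B k * r`, right of 0. The points before its
        -- start are covered by earlier sensors alone; the chain found for them ends at or beyond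
        -- that start and links to `k`.
        ... | no  Xk≰ with without-k {X k - B k * r} 0<left left≤z (λ y<left _ (left≤y , _) →
                contradiction (from x-y≤z⇔x≤y+z (≤-trans left≤y (≤-reflexive (+-comm _ _)))) (<⇒≱ y<left))
          where
          0<left : 0# < X k - B k * r
          0<left = ≰⇒> λ left≤0 → Xk≰
            (≤-trans (to x-y≤z⇔x≤y+z left≤0) (≤-reflexive (+-identityʳ (B k * r))))
          left≤z : X k - B k * r ≤ z
          left≤z = from x-y≤z⇔x≤y+z (≤-trans (≰⇒≥ z≰left) (≤-reflexive (+-comm _ _)))
        ...   | j , j<k , reach , left≤right =
                  k , ℕₚ.n<1+n k , link reach (≰⇒> Bk≰0) j<k (begin
                    X k                            ≤⟨ to x-y≤z⇔x≤y+z left≤right ⟩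
                    B k * r + (X j + B j * r)      ≈⟨ solve 4 (λ x b b′ r → b′ :* r :+ (x :+ b :* r) := x :+ (b :+ b′) :* r)
                                                      ≈-refl (X j) (B j) (B k) r ⟩
                    X j + (B j + B k) * r          ∎) , z≤right

      Covered⇒Crossing : (∀ y → 0# ≤ y → y ≤ 1# → Covered r n y) → Crossing r n
      Covered⇒Crossing cover =
        Covered⇒Reach n ℕₚ.≤-refl 0<1 λ y 0≤y y<1 → cover y 0≤y (proj₁ y<1)

-- From the best rate to an optimal radial assignment.

module Optimality {c ℓ₁ ℓ₂} (F : OrderedField c ℓ₁ ℓ₂) where
  open OrderedField F
  open OrderedFieldProperties F
  open StripCover F
  open RadSC F
  open RadSCAlgorithm F using (padded)
  open ≤-Reasoning poset

  padded-< : ∀ {n} (v : Fin n → Carrier) {k} (k<n : k ℕ.< n) → padded v k ≡ v (fromℕ< k<n)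
  padded-< {n} v {k} k<n with k ℕ.<? n
  ... | yes _   = ≡.refl
  ... | no  k≮n = contradiction k<n k≮n

  padded-toℕ : ∀ {n} (v : Fin n → Carrier) i → padded v (toℕ i) ≡ v i
  padded-toℕ v i = ≡.trans (padded-< v (toℕ<n i)) (≡.cong v (fromℕ<-toℕ i (toℕ<n i)))

  -- `τ` is the reciprocal of the least rate that admits a crossing. The product form avoids
  -- dividing by `τ`, and a non-positive `τ` expresses that no rate `r` with `0# ≤ r` crosses.
  IsBestRate : (X B : ℕ → Carrier) → Carrier → ℕ → Set (c ⊔ ℓ₁ ⊔ ℓ₂)
  IsBestRate X B τ n = ∀ {r} → 0# ≤ r → (1# ≤ τ * r) ⇔ Crossing X B r n

  -- A non-positive τ means that no positive lifetime is achievable; any radii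
  -- covering the strip at time 0 are then optimal.
  data IsRadius (τ b ρ : Carrier) : Set (c ⊔ ℓ₂) where
    dead  : τ ≤ 0# → ρ ≡ 1# → IsRadius τ b ρ
    alive : ¬ τ ≤ 0# → ρ ≡ b ÷ τ → IsRadius τ b ρ

  module _ {n : ℕ} (I : Instance n) where
    open Instance I

    X B : ℕ → Carrier
    X = padded x
    B = padded b

    X-sorted : ∀ {i j} → i ℕ.≤ j → j ℕ.< n → X i ≤ X j
    X-sorted {i} {j} i≤j j<n = ≡.subst₂ _≤_ (≡.sym (padded-< x i<n)) (≡.sym (padded-< x j<n))
      (x-sorted (≡.subst₂ ℕ._≤_ (≡.sym (toℕ-fromℕ< i<n)) (≡.sym (toℕ-fromℕ< j<n)) i≤j))
      where
      i<n = ℕₚ.≤-<-trans i≤j j<n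

    0≤X : ∀ {i} → i ℕ.< n → 0# ≤ X i
    0≤X i<n = ≡.subst (0# ≤_) (≡.sym (padded-< x i<n)) (0≤x (fromℕ< i<n))

    -- A sensor alive at time `t` satisfies `t * ρ i ≤ b i`. Hence its charge is positive and its
    -- disk lies inside the one of radius `b i ÷ t`.
    StripCoveredAt⇒Covered : ∀ {ρ t} → 0# < t → StripCoveredAt I ρ t →
                             ∀ y → 0# ≤ y → y ≤ 1# → Covered X B (t ⁻¹) n y
    StripCoveredAt⇒Covered {ρ} {t} 0<t covered y 0≤y y≤1 with covered y 0≤y y≤1
    ... | i , 0<ρ , t≤b÷ρ , x-ρ≤y , y≤x+ρ =
      toℕ i , toℕ<n i , ≡.subst (0# <_) (≡.sym (padded-toℕ b i)) 0<b ,
      ≡.subst₂ (λ x b → x ≤ y + b * t ⁻¹ × y ≤ x + b * t ⁻¹)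
        (≡.sym (padded-toℕ x i)) (≡.sym (padded-toℕ b i))
        (≤-trans (to x-y≤z⇔x≤y+z x-ρ≤y) (≤-trans (≤-reflexive (+-comm _ _)) (+-monoʳ-≤ y ρ≤b÷t)) ,
         ≤-trans y≤x+ρ (+-monoʳ-≤ (x i) ρ≤b÷t))
      where
      tρ≤b : t * ρ i ≤ b i
      tρ≤b = to (z≤x÷y⇔z*y≤x 0<ρ) t≤b÷ρ
      0<b : 0# < b i
      0<b = <-≤-trans (0<x*y 0<t 0<ρ) tρ≤b
      ρ≤b÷t : ρ i ≤ b i ÷ t
      ρ≤b÷t = from (z≤x÷y⇔z*y≤x 0<t) (≤-trans (≤-reflexive (*-comm (ρ i) t)) tρ≤b)

    module _ {τ : Carrier} (best : IsBestRate X B τ n) where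

      -- The cover at the final moment `t` gives a crossing at rate `t ⁻¹`, to which `best` applies.
      SurvivesUntil⇒≤ : ∀ {ρ t} → 0# < t → SurvivesUntil I ρ t → t ≤ τ
      SurvivesUntil⇒≤ {t = t} 0<t (0≤t , covered) = begin
        t               ≈⟨ *-identityˡ t ⟨
        1# * t          ≤⟨ to (z≤x÷y⇔z*y≤x 0<t) 1≤τ÷t ⟩
        τ               ∎
        where
        1≤τ÷t : 1# ≤ τ ÷ t
        1≤τ÷t = from (best 0≤t⁻¹) (Covered⇒Crossing X B X-sorted 0≤X 0≤t⁻¹
          (StripCoveredAt⇒Covered 0<t (covered t 0≤t ≤-refl)))
          where 0≤t⁻¹ = proj₁ (0<x⁻¹ 0<t)

      module _ {ρ : Fin n → Carrier} (radius : ∀ i → IsRadius τ (b i) (ρ i)) where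

        alive-optimal : ¬ τ ≤ 0# → IsOptimal I ρ
        alive-optimal τ≰0 = 0≤ρ , τ , (survives , bound ρ) , λ ρ′ T′ _ life → bound ρ′ T′ (proj₁ life)
          where
          0<τ : 0# < τ
          0<τ = ≰⇒> τ≰0
          ρ≡b÷τ : ∀ i → ρ i ≡ b i ÷ τ
          ρ≡b÷τ i with radius i
          ... | dead τ≤0 _  = contradiction τ≤0 τ≰0
          ... | alive _ eq  = eq
          0≤ρ : IsRadialAssignment I ρ
          0≤ρ i = ≡.subst (0# ≤_) (≡.sym (ρ≡b÷τ i)) (*-nonNegative (0≤b i) (proj₁ (0<x⁻¹ 0<τ)))
          bound : ∀ ρ′ T′ → SurvivesUntil I ρ′ T′ → T′ ≤ τ
          bound ρ′ T′ survives′ with T′ ≤? 0#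
          ... | yes T′≤0 = ≤-trans T′≤0 (proj₁ 0<τ)
          ... | no  T′≰0 = SurvivesUntil⇒≤ (≰⇒> T′≰0) survives′
          -- The rate `τ ⁻¹` is the equality case of `best`.
          crossing : Crossing X B (τ ⁻¹) n
          crossing = to (best (proj₁ (0<x⁻¹ 0<τ))) (≤-reflexive (≈-sym (*-inverseʳ (<⇒≉0 0<τ))))
          survives : SurvivesUntil I ρ τ
          survives = proj₁ 0<τ , covers
            where
            covers : ∀ t → 0# ≤ t → t ≤ τ → StripCoveredAt I ρ t
            covers t _ t≤τ y 0≤y y≤1 with Crossing⇒Covered X B crossing 0≤y y≤1
            ... | k , k<n , 0<B , X≤ , y≤ =
              i , ≡.subst (λ ρ → 0# < ρ × t ≤ b i ÷ ρ × x i - ρ ≤ y × y ≤ x i + ρ) (≡.sym (ρ≡b÷τ i))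
                (0<b÷τ , from (z≤x÷y⇔z*y≤x 0<b÷τ) (begin
                  t * (b i ÷ τ)   ≤⟨ *-monoʳ-≤ (proj₁ 0<b÷τ) t≤τ ⟩
                  τ * (b i ÷ τ)   ≈⟨ *-comm τ (b i ÷ τ) ⟩
                  b i ÷ τ * τ     ≈⟨ ÷-cancelʳ (<⇒≉0 0<τ) ⟩
                  b i             ∎) ,
                 from x-y≤z⇔x≤y+z (begin
                  x i             ≡⟨ padded-< x k<n ⟨
                  X k             ≤⟨ X≤ ⟩
                  y + B k ÷ τ     ≈⟨ +-comm y (B k ÷ τ) ⟩
                  B k ÷ τ + y     ≡⟨ ≡.cong (λ b → b ÷ τ + y) (padded-< b k<n) ⟩
                  b i ÷ τ + y     ∎) ,
                 ≡.subst₂ (λ x b → y ≤ x + b ÷ τ) (padded-< x k<n) (padded-< b k<n) y≤)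
              where
              i : Fin n
              i = fromℕ< k<n
              0<b÷τ : 0# < b i ÷ τ
              0<b÷τ = 0<x*y (≡.subst (0# <_) (padded-< b k<n) 0<B) (0<x⁻¹ 0<τ)

        dead-optimal : .{{_ : ℕ.NonZero n}} → τ ≤ 0# → IsOptimal I ρ
        dead-optimal τ≤0 = 0≤ρ , 0# , (survives , bound ρ) , λ ρ′ T′ _ life → bound ρ′ T′ (proj₁ life)
          where
          ρ≡1 : ∀ i → ρ i ≡ 1#
          ρ≡1 i with radius i
          ... | dead _ eq   = eq
          ... | alive τ≰0 _ = contradiction τ≤0 τ≰0
          0≤ρ : IsRadialAssignment I ρ
          0≤ρ i = ≡.subst (0# ≤_) (≡.sym (ρ≡1 i)) (proj₁ 0<1)
          bound : ∀ ρ′ T′ → SurvivesUntil I ρ′ T′ → T′ ≤ 0#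
          bound ρ′ T′ survives′ with T′ ≤? 0#
          ... | yes T′≤0 = T′≤0
          ... | no  T′≰0 = ≤-trans (SurvivesUntil⇒≤ (≰⇒> T′≰0) survives′) τ≤0
          -- Any sensor will do: its location lies in the strip, so radius 1 covers everything, and
          -- any charge, even 0, lasts until time 0.
          i : Fin n
          i = fromℕ< (ℕ.>-nonZero⁻¹ n)
          survives : SurvivesUntil I ρ 0#
          survives = ≤-refl , λ t _ t≤0 y 0≤y y≤1 →
            i , ≡.subst (λ ρ → 0# < ρ × t ≤ b i ÷ ρ × x i - ρ ≤ y × y ≤ x i + ρ) (≡.sym (ρ≡1 i))
              (0<1 , ≤-trans t≤0 (*-nonNegative (0≤b i) (proj₁ (0<x⁻¹ 0<1))) ,
               from x-y≤z⇔x≤y+z (begin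
                 x i      ≤⟨ x≤1 i ⟩
                 1#       ≈⟨ +-identityʳ 1# ⟨
                 1# + 0#  ≤⟨ +-monoʳ-≤ 1# 0≤y ⟩
                 1# + y   ∎) ,
               (begin
                 y        ≤⟨ y≤1 ⟩
                 1#       ≈⟨ +-identityˡ 1# ⟨
                 0# + 1#  ≤⟨ +-monoˡ-≤ 1# (0≤x i) ⟩
                 x i + 1# ∎))

        IsRadius⇒IsOptimal : .{{_ : ℕ.NonZero n}} → IsOptimal I ρ
        IsRadius⇒IsOptimal with τ ≤? 0#
        ... | yes τ≤0 = dead-optimal τ≤0
        ... | no  τ≰0 = alive-optimal τ≰0

-- A Hoare logic with time bounds for the real RAM.

module ProgramLogic {c ℓ₁ ℓ₂} (F : OrderedField c ℓ₁ ℓ₂) where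
  open OrderedField F
  open OrderedFieldProperties F
  open RealRAM F
  open State

  -- A total-correctness triple with a time budget. The budget is only an upper bound, so branches
  -- of different cost can share it.
  record Runs {q} (P : Program) (σ : State) (C : ℕ) (Q : State → Set q) : Set (c ⊔ q) where
    constructor halts
    field
      {σ′} : State
      {t}  : ℕ
      run  : P ⊢ σ ⇓ σ′ in-time t
      t≤C  : t ℕ.≤ C
      post : Q σ′

  assign : State → Cell → Carrier → State
  assign σ u v = record σ { reals = updateCell σ u v (reals σ) }

  -- Total, unlike eval: a division by 0# takes the unspecified value of ÷, and
  -- Defined excludes it.
  value : State → RealExp → Carrier
  value σ 𝟘        = 0#
  value σ 𝟙        = 1#
  value σ (copy u) = real σ u
  value σ (u ⊕ v)  = real σ u + real σ v
  value σ (u ⊖ v)  = real σ u - real σ v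
  value σ (u ⊗ v)  = real σ u * real σ v
  value σ (u ⊘ v)  = real σ u ÷ real σ v

  after : Instr → State → State
  after (r ≔ᶜ k)    σ = setReg σ r k
  after (r ≔ʳ s)    σ = setReg σ r (regs σ s)
  after (inc r)     σ = setReg σ r (suc (regs σ r))
  after (dec r)     σ = setReg σ r (ℕ.pred (regs σ r))
  after (load r u)  σ = setReg σ r (int σ u)
  after (store u r) σ = record σ { ints = updateCell σ u (regs σ r) (ints σ) }
  after (u ≔ e)     σ = assign σ u (value σ e)

  Defined : Instr → State → Set ℓ₁
  Defined (u ≔ v ⊘ w) σ = ¬ real σ w ≈ 0#
  Defined _           σ = ⊤

  exec-after : ∀ ι {σ} → Defined ι σ → exec ι σ ≡ just (after ι σ)
  exec-after (r ≔ᶜ k)     _ = ≡.refl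
  exec-after (r ≔ʳ s)     _ = ≡.refl
  exec-after (inc r)      _ = ≡.refl
  exec-after (dec r)      _ = ≡.refl
  exec-after (load r u)   _ = ≡.refl
  exec-after (store u r)  _ = ≡.refl
  exec-after (u ≔ 𝟘)      _ = ≡.refl
  exec-after (u ≔ 𝟙)      _ = ≡.refl
  exec-after (u ≔ copy v) _ = ≡.refl
  exec-after (u ≔ v ⊕ w)  _ = ≡.refl
  exec-after (u ≔ v ⊖ w)  _ = ≡.refl
  exec-after (u ≔ v ⊗ w)  _ = ≡.refl
  exec-after (u ≔ v ⊘ w) {σ} w≉0 with real σ w ≟ 0#
  ... | yes w≈0 = contradiction w≈0 w≉0
  ... | no  _   = ≡.refl

  module _ {q} {Q : State → Set q} where

    weaken-time : ∀ {P σ C D} → C ℕ.≤ D → Runs P σ C Q → Runs P σ D Q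
    weaken-time C≤D (halts run t≤C post) = halts run (ℕₚ.≤-trans t≤C C≤D) post

    runs-skip : ∀ {σ} → Q σ → Runs skip σ 0 Q
    runs-skip post = halts ⇓-skip z≤n post

    runs-instr : ∀ {ι σ} → Defined ι σ → Q (after ι σ) → Runs (instr ι) σ 1 Q
    runs-instr {ι} defined post = halts (⇓-instr (exec-after ι defined)) (s≤s z≤n) post

    runs-map : ∀ {r} {R : State → Set r} {P σ C} → (∀ {σ′} → R σ′ → Q σ′) → Runs P σ C R → Runs P σ C Q
    runs-map f (halts run t≤C post) = halts run t≤C (f post)

    infixr 1 _⨟_ _≫=_

    -- The intermediate state is the explicit term `after ι σ`, so straight-line code is executed
    -- symbolically by reduction. `_≫=_` is for places where the state is known only through a
    -- postcondition.
    _⨟_ : ∀ {ι P σ C} → Defined ι σ → Runs P (after ι σ) C Q → Runs (instr ι ⨾ P) σ (suc C) Q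
    _⨟_ {ι} defined (halts run t≤C post) = halts (⇓-seq (⇓-instr (exec-after ι defined)) run) (s≤s t≤C) post

    _≫=_ : ∀ {r} {R : State → Set r} {P P′ σ C D} → Runs P σ C R →
           (∀ {σ′} → R σ′ → Runs P′ σ′ D Q) → Runs (P ⨾ P′) σ (C ℕ.+ D) Q
    halts run t≤C mid ≫= continue with continue mid
    ... | halts run′ u≤D post = halts (⇓-seq run run′) (ℕₚ.+-mono-≤ t≤C u≤D) post

    runs-if : ∀ {u v P P′ σ C D} → (real σ u ≤ real σ v → Runs P σ C Q) →
              (¬ real σ u ≤ real σ v → Runs P′ σ D Q) →
              Runs (if (u ≤ᴿ v) P P′) σ (suc (C ℕ.⊔ D)) Q
    runs-if {u} {v} {σ = σ} {C} {D} then else with real σ u ≤? real σ v in eq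
    ... | yes u≤v with then u≤v
    ...   | halts run t≤C post =
            halts (⇓-then (≡.cong does eq) run) (s≤s (ℕₚ.m≤n⇒m≤n⊔o D t≤C)) post
    runs-if {u} {v} {σ = σ} {C} {D} then else | no u≰v with else u≰v
    ...   | halts run t≤D post =
            halts (⇓-else (≡.cong does eq) run) (s≤s (ℕₚ.m≤n⇒m≤o⊔n C t≤D)) post

  -- `k` is the exact number of iterations left. Each costs its body and one test; the failing test
  -- adds the final 1.
  runs-while : ∀ {ℓ} {g P C} (Inv : ℕ → State → Set ℓ) →
               (∀ {k σ} → Inv (suc k) σ → test g σ ≡ true × Runs P σ C (Inv k)) →
               (∀ {σ} → Inv 0 σ → test g σ ≡ false) →
               ∀ k {σ} → Inv k σ → Runs (while g P) σ (suc (k ℕ.* suc C)) (Inv 0)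
  runs-while Inv body exit zero inv = halts (⇓-exit (exit inv)) (s≤s z≤n) inv
  runs-while {C = C} Inv body exit (suc k) inv with body inv
  ... | continue , halts run t≤C inv′ with runs-while Inv body exit k inv′
  ...   | halts runs u≤ inv″ =
    halts (⇓-repeat continue run runs)
      (s≤s (ℕₚ.≤-trans (ℕₚ.+-mono-≤ t≤C u≤) (ℕₚ.≤-reflexive (ℕₚ.+-suc C (k ℕ.* suc C))))) inv″

  test-≤ᴺ : ∀ {r s σ} → regs σ r ℕ.≤ regs σ s → test (r ≤ᴺ s) σ ≡ true
  test-≤ᴺ {r} {s} {σ} = dec-true (regs σ r ℕ.≤? regs σ s)

  test-≰ᴺ : ∀ {r s σ} → ¬ regs σ r ℕ.≤ regs σ s → test (r ≤ᴺ s) σ ≡ false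
  test-≰ᴺ {r} {s} {σ} = dec-false (regs σ r ℕ.≤? regs σ s)

  minOf maxOf : Cell → Cell → Cell → Program
  minOf w u v = if (u ≤ᴿ v) (instr (w ≔ copy u)) (instr (w ≔ copy v))
  maxOf w u v = if (u ≤ᴿ v) (instr (w ≔ copy v)) (instr (w ≔ copy u))

  -- The result is propositionally one of the arguments, so matching on `≡.refl` substitutes it. On
  -- a tie either argument is allowed.
  IsMin IsMax : Carrier → Carrier → Carrier → Set (c ⊔ ℓ₂)
  IsMin x y m = x ≤ y × m ≡ x ⊎ y ≤ x × m ≡ y
  IsMax x y m = x ≤ y × m ≡ y ⊎ y ≤ x × m ≡ x

  runs-minOf : ∀ {w u v σ} →
    Runs (minOf w u v) σ 2 λ σ′ → ∃ λ m → IsMin (real σ u) (real σ v) m × σ′ ≡ assign σ w m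
  runs-minOf = runs-if
    (λ u≤v → runs-instr tt (_ , inj₁ (u≤v , ≡.refl) , ≡.refl))
    (λ u≰v → runs-instr tt (_ , inj₂ (≰⇒≥ u≰v , ≡.refl) , ≡.refl))

  runs-maxOf : ∀ {w u v σ} →
    Runs (maxOf w u v) σ 2 λ σ′ → ∃ λ m → IsMax (real σ u) (real σ v) m × σ′ ≡ assign σ w m
  runs-maxOf = runs-if
    (λ u≤v → runs-instr tt (_ , inj₁ (u≤v , ≡.refl) , ≡.refl))
    (λ u≰v → runs-instr tt (_ , inj₂ (≰⇒≥ u≰v , ≡.refl) , ≡.refl))

  IsMin⇒≤⇔ : ∀ {x y m} → IsMin x y m → ∀ {r} → (m ≤ r) ⇔ (x ≤ r ⊎ y ≤ r)
  IsMin⇒≤⇔ (inj₁ (x≤y , ≡.refl)) = mk⇔ inj₁ [ id , ≤-trans x≤y ]′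
  IsMin⇒≤⇔ (inj₂ (y≤x , ≡.refl)) = mk⇔ inj₂ [ ≤-trans y≤x , id ]′

  IsMax⇒≤⇔ : ∀ {x y m} → IsMax x y m → ∀ {r} → (m ≤ r) ⇔ (x ≤ r × y ≤ r)
  IsMax⇒≤⇔ (inj₁ (x≤y , ≡.refl)) = mk⇔ (λ y≤r → ≤-trans x≤y y≤r , y≤r) proj₂
  IsMax⇒≤⇔ (inj₂ (y≤x , ≡.refl)) = mk⇔ (λ x≤r → x≤r , ≤-trans y≤x x≤r) proj₁

  IsMax⇒≤*⇔ : ∀ {x y m} → IsMax x y m → ∀ {r z} → 0# ≤ r → (z ≤ m * r) ⇔ (z ≤ x * r ⊎ z ≤ y * r)
  IsMax⇒≤*⇔ (inj₁ (x≤y , ≡.refl)) 0≤r = mk⇔ inj₂ [ (λ z≤ → ≤-trans z≤ (*-monoʳ-≤ 0≤r x≤y)) , id ]′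
  IsMax⇒≤*⇔ (inj₂ (y≤x , ≡.refl)) 0≤r = mk⇔ inj₁ [ id , (λ z≤ → ≤-trans z≤ (*-monoʳ-≤ 0≤r y≤x)) ]′

-- Extends by one entry the prefix of an array on which an invariant holds; it serves both the table
-- `ds` and the output `ρs`.
update-≺ : ∀ {a p} {A : Set a} (P : ℕ → A → Set p) {k v f} →
           (∀ {j} → j ℕ.< k → P j (f j)) → P k v → ∀ {j} → j ℕ.< suc k → P j (update k v f j)
update-≺ P {k} below at {j} j<1+k with j ℕ.≡ᵇ k in eq
... | true  = ≡.subst (λ j → P j _) (≡.sym (ℕₚ.≡ᵇ⇒≡ j k (from T-≡ eq))) at
... | false with ℕₚ.m<1+n⇒m<n∨m≡n j<1+k
...   | inj₁ j<k    = below j<k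
...   | inj₂ ≡.refl with ≡.trans (≡.sym eq) (to T-≡ (ℕₚ.≡⇒≡ᵇ k k ≡.refl))
...     | ()

-- The recurrence for reachability thresholds and for the best rate.

module Recurrence {c ℓ₁ ℓ₂} (F : OrderedField c ℓ₁ ℓ₂) where
  open OrderedField F
  open OrderedFieldProperties F
  open StripCover F
  open Optimality F using (IsBestRate)
  open ProgramLogic F
  open ≤-Reasoning poset

  module _ (X B : ℕ → Carrier) where

    -- Chains to `j` whose last link, if any, starts at index `k` or later. The inner loop lowers
    -- `k` from `j`, where no predecessor qualifies, to 0, where all do.
    ReachFrom : ℕ → ℕ → Carrier → Set (ℓ₁ ⊔ ℓ₂)
    ReachFrom k j r = X j ≤ B j * r ⊎
      ∃ λ i → k ℕ.≤ i × i ℕ.< j × Reach X B r i × X j ≤ X i + (B i + B j) * r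

    -- Describing a threshold by an equivalence for every `r` turns maxima into conjunctions and
    -- minima into disjunctions. Sensors without charge are excluded: the program neither writes nor
    -- reads their entries.
    IsReachBound : (ℕ → Carrier) → ℕ → Set (c ⊔ ℓ₁ ⊔ ℓ₂)
    IsReachBound d j = ∀ {i} → i ℕ.< j → 0# < B i → ∀ {r} → (d i ≤ r) ⇔ Reach X B r i

    IsReachFromBound : Carrier → ℕ → ℕ → Set (c ⊔ ℓ₁ ⊔ ℓ₂)
    IsReachFromBound a k j = ∀ {r} → (a ≤ r) ⇔ ReachFrom k j r

    reachFrom-init : ∀ {j} → 0# < B j → IsReachFromBound (X j ÷ B j) j j
    reachFrom-init 0<B = mk⇔
      (λ ≤r → inj₁ (to (x÷y≤z⇔x≤y*z 0<B) ≤r))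
      [ from (x÷y≤z⇔x≤y*z 0<B) , (λ (_ , j≤i , i<j , _) → contradiction j≤i (ℕₚ.<⇒≱ i<j)) ]′

    reachFrom-drop : ∀ {a k j} → B k ≤ 0# → IsReachFromBound a (suc k) j → IsReachFromBound a k j
    reachFrom-drop {k = k} Bk≤0 bound = mk⇔
      (λ a≤r → [ inj₁ , (λ (i , k<i , rest) → inj₂ (i , ℕₚ.<⇒≤ k<i , rest)) ]′ (to bound a≤r))
      [ from bound ∘ inj₁ , (λ (i , k≤i , i<j , reach , X≤) →
          from bound (inj₂ (i , ℕₚ.≤∧≢⇒< k≤i (λ { ≡.refl → <⇒≱ (Reach⇒0<B X B reach) Bk≤0 }) , i<j , reach , X≤))) ]′

    -- The link from `k` to `j` is available at rate `r` when `k` is reachable and the two disks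
    -- meet, hence the maximum `w`. It is one more alternative for reaching `j`, hence the minimum.
    reachFrom-step : ∀ {a a′ w d k j} → k ℕ.< j → 0# < B k → 0# < B j →
      IsReachBound d j → IsMax ((X j - X k) ÷ (B k + B j)) (d k) w → IsMin a w a′ →
      IsReachFromBound a (suc k) j → IsReachFromBound a′ k j
    reachFrom-step {a} {a′} {w} {d} {k} {j} k<j 0<Bk 0<Bj table isMax isMin bound {r} = mk⇔
      (λ a′≤r → [ old , new ]′ (to (IsMin⇒≤⇔ isMin) a′≤r))
      [ from (IsMin⇒≤⇔ isMin) ∘ inj₁ ∘ from bound ∘ inj₁ , split ]′
      where
      threshold : ((X j - X k) ÷ (B k + B j) ≤ r) ⇔ (X j ≤ X k + (B k + B j) * r)
      threshold = mk⇔
        (to x-y≤z⇔x≤y+z ∘ to (x÷y≤z⇔x≤y*z (0<x+y 0<Bk 0<Bj)))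
        (from (x÷y≤z⇔x≤y*z (0<x+y 0<Bk 0<Bj)) ∘ from x-y≤z⇔x≤y+z)
      old : a ≤ r → ReachFrom k j r
      old a≤r = [ inj₁ , (λ (i , k<i , rest) → inj₂ (i , ℕₚ.<⇒≤ k<i , rest)) ]′ (to bound a≤r)
      new : w ≤ r → ReachFrom k j r
      new w≤r with to (IsMax⇒≤⇔ isMax) w≤r
      ... | ÷≤r , dk≤r = inj₂ (k , ℕₚ.≤-refl , k<j , to (table k<j 0<Bk) dk≤r , to threshold ÷≤r)
      split : (∃ λ i → k ℕ.≤ i × i ℕ.< j × Reach X B r i × X j ≤ X i + (B i + B j) * r) → a′ ≤ r
      split (i , k≤i , i<j , reach , X≤) with ℕₚ.m≤n⇒m<n∨m≡n k≤i
      ... | inj₁ k<i    = from (IsMin⇒≤⇔ isMin) (inj₁ (from bound (inj₂ (i , k<i , i<j , reach , X≤))))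
      ... | inj₂ ≡.refl = from (IsMin⇒≤⇔ isMin) (inj₂ (from (IsMax⇒≤⇔ isMax)
                            (from threshold X≤ , from (table k<j 0<Bk) reach)))

    reachFrom-0 : ∀ {a j} → 0# < B j → IsReachFromBound a 0 j → ∀ {r} → (a ≤ r) ⇔ Reach X B r j
    reachFrom-0 0<B bound = mk⇔
      (λ a≤r → [ base 0<B , (λ (i , _ , i<j , reach , X≤) → link reach 0<B i<j X≤) ]′ (to bound a≤r))
      (λ { (base _ X≤)           → from bound (inj₁ X≤)
         ; (link reach _ i<j X≤) → from bound (inj₂ (_ , z≤n , i<j , reach , X≤)) })

    -- The zero that the initial memory holds is the right starting value for the maximum `τ`.
    bestRate-zero : IsBestRate X B 0# 0
    bestRate-zero {r} _ = mk⇔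
      (λ 1≤0r → contradiction (≤-trans 1≤0r (≤-reflexive (zeroˡ r))) (<⇒≱ 0<1))
      λ ()

    bestRate-skip : ∀ {τ j} → B j ≤ 0# → IsBestRate X B τ j → IsBestRate X B τ (suc j)
    bestRate-skip {j = j} Bj≤0 best 0≤r = mk⇔
      (λ 1≤ → let i , i<j , rest = to (best 0≤r) 1≤ in i , ℕₚ.m<n⇒m<1+n i<j , rest)
      (λ (i , i<1+j , reach , 1≤right) → from (best 0≤r)
        (i , ℕₚ.≤∧≢⇒< (ℕₚ.m<1+n⇒m≤n i<1+j) (λ { ≡.refl → <⇒≱ (Reach⇒0<B X B reach) Bj≤0 }) ,
         reach , 1≤right))

    module _ {a w j} (0<B : 0# < B j) (bound : ∀ {r} → (a ≤ r) ⇔ Reach X B r j)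
             (isMax : IsMax ((1# - X j) ÷ B j) a w) where

      exit⇔ : ∀ {r} → (w ≤ r) ⇔ (Reach X B r j × 1# ≤ X j + B j * r)
      exit⇔ = mk⇔
        (λ w≤r → let ÷≤r , a≤r = to (IsMax⇒≤⇔ isMax) w≤r in
          to bound a≤r , to x-y≤z⇔x≤y+z (to (x÷y≤z⇔x≤y*z 0<B) ÷≤r))
        (λ (reach , 1≤right) → from (IsMax⇒≤⇔ isMax)
          (from (x÷y≤z⇔x≤y*z 0<B) (from x-y≤z⇔x≤y+z 1≤right) , from bound reach))

      -- The threshold `w` satisfies `w ≤ w`, so it is itself a rate at which a chain touches the
      -- right wall, and such rates are positive.
      0<exit : 0# < w
      0<exit = let reach , 1≤right = to exit⇔ ≤-refl in 1≤right⇒0<r X B reach 1≤right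

      -- A crossing ends either before `j` or at `j`. Since `w` is positive, `w ≤ r` is the same as
      -- `1# ≤ (1# ÷ w) * r`, so the two cases combine into a maximum of reciprocals.
      bestRate-step : ∀ {τ τ′} → IsMax τ (1# ÷ w) τ′ → IsBestRate X B τ j → IsBestRate X B τ′ (suc j)
      bestRate-step {τ} {τ′} isMax′ best {r} 0≤r = mk⇔
        (λ 1≤ → [ (λ 1≤ → let i , i<j , rest = to (best 0≤r) 1≤ in i , ℕₚ.m<n⇒m<1+n i<j , rest)
                , (λ 1≤ → j , ℕₚ.n<1+n j , to exit⇔ (to reciprocal 1≤)) ]′ (to (IsMax⇒≤*⇔ isMax′ 0≤r) 1≤))
        split
        where
        reciprocal : (1# ≤ (1# ÷ w) * r) ⇔ (w ≤ r)
        reciprocal = mk⇔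
          (λ 1≤ → ≤-trans (≤-reflexive (≈-sym (*-identityˡ w)))
            (to (z≤x÷y⇔z*y≤x 0<exit) (≤-trans 1≤ (≤-reflexive 1÷w*r≈r÷w))))
          (λ w≤r → ≤-trans (from (z≤x÷y⇔z*y≤x 0<exit) (≤-trans (≤-reflexive (*-identityˡ w)) w≤r))
            (≤-reflexive (≈-sym 1÷w*r≈r÷w)))
          where
          1÷w*r≈r÷w : (1# ÷ w) * r ≈ r ÷ w
          1÷w*r≈r÷w = ≈-trans (*-congʳ (*-identityˡ (w ⁻¹))) (*-comm (w ⁻¹) r)
        split : Crossing X B r (suc j) → 1# ≤ τ′ * r
        split (i , i<1+j , reach , 1≤right) with ℕₚ.m<1+n⇒m<n∨m≡n i<1+j
        ... | inj₁ i<j    = from (IsMax⇒≤*⇔ isMax′ 0≤r) (inj₁ (from (best 0≤r) (i , i<j , reach , 1≤right)))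
        ... | inj₂ ≡.refl = from (IsMax⇒≤*⇔ isMax′ 0≤r) (inj₂ (from reciprocal (from exit⇔ (reach , 1≤right))))

-- The program, its time budget and its loop invariants.

stageTime solverTime : ℕ → ℕ
-- The summands follow the code: 12 is the 11 steps of `relaxStep` and its loop test, the other 11
-- is `finish`. The 6 in `solverTime` is the 5 steps of `emit` and a loop test.
stageTime n  = 2 ℕ.+ (suc (3 ℕ.+ (suc (n ℕ.* 12) ℕ.+ 11)) ℕ.+ 1)
solverTime n = suc (suc (n ℕ.* suc (stageTime n)) ℕ.+ suc (suc (n ℕ.* 6)))

module Solver {c ℓ₁ ℓ₂} (F : OrderedField c ℓ₁ ℓ₂) where
  open OrderedField F
  open OrderedFieldProperties F
  open StripCover F
  open Optimality F using (IsBestRate; IsRadius; dead; alive; padded-toℕ; IsRadius⇒IsOptimal)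
  open ProgramLogic F
  open Recurrence F
  open RadSC F
  open RealRAM F
  open RadSCAlgorithm F
  open State

  last j i origin one : Reg
  last   = 0
  j      = 1
  i      = 2
  origin = 3
  one    = 4

  xs bs ρs ds : Arr
  xs = 0
  bs = 1
  ρs = 2
  ds = 3

  -- Scalars live at index 0 of their own arrays; resetting the register origin
  -- to the literal 0 at the head of each block lets their cells compute.
  w τ 𝟎 acc u : Cell
  w   = 4 [ origin ]
  τ   = 5 [ origin ]
  𝟎   = 6 [ origin ]
  acc = 7 [ origin ]
  u   = 8 [ origin ]

  candidate relaxStep finish relax stage emit solver : Program
  candidate =
    instr (w ≔ xs [ j ] ⊖ xs [ i ]) ⨾
    instr (u ≔ bs [ i ] ⊕ bs [ j ]) ⨾
    instr (w ≔ w ⊘ u) ⨾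
    maxOf w w (ds [ i ]) ⨾
    minOf acc acc w
  relaxStep =
    instr (origin ≔ᶜ 0) ⨾
    instr (dec i) ⨾
    instr (𝟎 ≔ 𝟘) ⨾
    if ((bs [ i ]) ≤ᴿ 𝟎) skip candidate
  finish =
    instr (origin ≔ᶜ 0) ⨾
    instr (ds [ j ] ≔ copy acc) ⨾
    instr (w ≔ 𝟙) ⨾
    instr (w ≔ w ⊖ xs [ j ]) ⨾
    instr (w ≔ w ⊘ bs [ j ]) ⨾
    maxOf w w acc ⨾
    instr (u ≔ 𝟙) ⨾
    instr (u ≔ u ⊘ w) ⨾
    maxOf τ τ u
  relax =
    instr (acc ≔ xs [ j ] ⊘ bs [ j ]) ⨾
    -- `relaxStep` decrements `i` before using it, so starting from `j` it visits the predecessors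
    -- `j - 1` down to 0.
    instr (i ≔ʳ j) ⨾
    instr (one ≔ᶜ 1) ⨾
    while (one ≤ᴺ i) relaxStep ⨾
    finish
  stage =
    instr (origin ≔ᶜ 0) ⨾
    instr (𝟎 ≔ 𝟘) ⨾
    if ((bs [ j ]) ≤ᴿ 𝟎) skip relax ⨾
    instr (inc j)
  emit =
    instr (origin ≔ᶜ 0) ⨾
    instr (𝟎 ≔ 𝟘) ⨾
    if (τ ≤ᴿ 𝟎) (instr (ρs [ j ] ≔ 𝟙)) (instr (ρs [ j ] ≔ bs [ j ] ⊘ τ)) ⨾
    instr (inc j)
  solver =
    -- Register 0 now holds `n - 1`, so the available test `j ≤ᴺ last` decides `j < n`. This is
    -- exact because `n` is nonzero.
    instr (dec last) ⨾
    while (j ≤ᴺ last) stage ⨾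
    instr (j ≔ᶜ 0) ⨾
    while (j ≤ᴺ last) emit

  module _ (n : ℕ) (X B : ℕ → Carrier) where

    -- Indexed by the components of the state it mentions rather than by the state: writes to other
    -- registers and arrays reduce away, and the same proof serves the new state.
    record Frame (σxs σbs : ℕ → Carrier) (σlast σj todo : ℕ) : Set c where
      field
        xs≡       : σxs ≡ X
        bs≡       : σbs ≡ B
        last≡     : suc σlast ≡ n
        remaining : σj ℕ.+ todo ≡ suc σlast

    InFrame : ℕ → State → Set c
    InFrame todo σ = Frame (reals σ 0) (reals σ 1) (regs σ 0) (regs σ 1) todo

    record Table (σxs σbs σds : ℕ → Carrier) (στ : Carrier) (σj : ℕ) : Set (c ⊔ ℓ₁ ⊔ ℓ₂) where
      field
        reachBound : IsReachBound σxs σbs σds σj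
        bestRate   : IsBestRate σxs σbs στ σj

    Tabulated : State → Set (c ⊔ ℓ₁ ⊔ ℓ₂)
    Tabulated σ = Table (reals σ 0) (reals σ 1) (reals σ 3) (reals σ 5 0) (regs σ 1)

    record Relaxing (todo k : ℕ) (σ : State) : Set (c ⊔ ℓ₁ ⊔ ℓ₂) where
      field
        inFrame   : InFrame (suc todo) σ
        tabulated : Tabulated σ
        0<bj      : 0# < reals σ 1 (regs σ 1)
        one≡      : regs σ 4 ≡ 1
        i≡        : regs σ 2 ≡ k
        k≤j       : k ℕ.≤ regs σ 1
        bound     : IsReachFromBound (reals σ 0) (reals σ 1) (reals σ 7 0) k (regs σ 1)

      open Table tabulated public

    Staged : ℕ → State → Set (c ⊔ ℓ₁ ⊔ ℓ₂)
    Staged todo σ = InFrame todo σ × Tabulated σ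

    record Emission (σxs σbs σρs : ℕ → Carrier) (στ : Carrier) (σj : ℕ) : Set (c ⊔ ℓ₁ ⊔ ℓ₂) where
      field
        bestRate : IsBestRate σxs σbs στ n
        radii    : ∀ {k} → k ℕ.< σj → IsRadius στ (σbs k) (σρs k)

    Emitting : ℕ → State → Set (c ⊔ ℓ₁ ⊔ ℓ₂)
    Emitting todo σ = InFrame todo σ × Emission (reals σ 0) (reals σ 1) (reals σ 2) (reals σ 5 0) (regs σ 1)

    advance : ∀ {σxs σbs σlast σj todo} → Frame σxs σbs σlast σj (suc todo) → Frame σxs σbs σlast (suc σj) todo
    advance {σj = σj} {todo} frame = record
      { Frame frame ; remaining = ≡.trans (≡.sym (ℕₚ.+-suc σj todo)) (Frame.remaining frame) }

    j≤last : ∀ {σxs σbs σlast σj todo} → Frame σxs σbs σlast σj (suc todo) → σj ℕ.≤ σlast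
    j≤last {σj = σj} {todo} frame = ℕₚ.≤-trans (ℕₚ.m≤m+n σj todo)
      (ℕₚ.≤-reflexive (ℕₚ.suc-injective (Frame.remaining (advance frame))))

    j≡n : ∀ {σxs σbs σlast σj} → Frame σxs σbs σlast σj 0 → σj ≡ n
    j≡n {σj = σj} frame = ≡.trans (≡.sym (ℕₚ.+-identityʳ σj)) (≡.trans (Frame.remaining frame) (Frame.last≡ frame))

    j<n : ∀ {σxs σbs σlast σj todo} → Frame σxs σbs σlast σj (suc todo) → σj ℕ.< n
    j<n frame = ≡.subst (_ ℕ.<_) (Frame.last≡ frame) (s≤s (j≤last frame))

    continue : ∀ {todo σ} → InFrame (suc todo) σ → test (j ≤ᴺ last) σ ≡ true
    continue {σ = σ} frame = test-≤ᴺ {j} {last} {σ} (j≤last frame)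

    exit : ∀ {σ} → InFrame 0 σ → test (j ≤ᴺ last) σ ≡ false
    exit {σ} frame = test-≰ᴺ {j} {last} {σ} λ j≤last →
      ℕₚ.1+n≰n (≡.subst (ℕ._≤ regs σ 0) (≡.trans (j≡n frame) (≡.sym (Frame.last≡ frame))) j≤last)

    runs-relaxStep : ∀ {todo k σ} → Relaxing todo (suc k) σ → Runs relaxStep σ 11 (Relaxing todo k)
    runs-relaxStep {todo} inv = go inv (≡.cong ℕ.pred (Relaxing.i≡ inv))
      where
      -- Matching this equation replaces `k` by the decremented register, so the cells indexed by
      -- `i` compute to entries at `k`.
      go : ∀ {k σ} → Relaxing todo (suc k) σ → ℕ.pred (regs σ 2) ≡ k → Runs relaxStep σ 11 (Relaxing todo k)
      go {σ = σ} inv ≡.refl =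
        tt ⨟ tt ⨟ tt ⨟ runs-if
          (λ bi≤0 → runs-skip record
            { inFrame = inFrame ; tabulated = tabulated ; 0<bj = 0<bj ; one≡ = one≡ ; i≡ = ≡.refl
            ; k≤j = ℕₚ.<⇒≤ k≤j ; bound = reachFrom-drop (reals σ 0) (reals σ 1) bi≤0 bound })
          (λ bi≰0 → tt ⨟ tt ⨟ <⇒≉0 (0<x+y (≰⇒> bi≰0) 0<bj) ⨟ runs-maxOf ≫=
            λ { (w , isMax , ≡.refl) → runs-map
              (λ { (a , isMin , ≡.refl) → record
                { inFrame = inFrame ; tabulated = tabulated ; 0<bj = 0<bj ; one≡ = one≡ ; i≡ = ≡.refl
                ; k≤j = ℕₚ.<⇒≤ k≤j
                ; bound = reachFrom-step (reals σ 0) (reals σ 1) k≤j (≰⇒> bi≰0) 0<bj reachBound isMax isMin bound } })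
              runs-minOf })
        where open Relaxing inv

    runs-relaxLoop : ∀ {todo k σ} → Relaxing todo k σ →
                     Runs (while (one ≤ᴺ i) relaxStep) σ (suc (k ℕ.* 12)) (Relaxing todo 0)
    runs-relaxLoop {todo} {k} = runs-while (Relaxing todo)
      (λ {_} {σ} inv → test-≤ᴺ {one} {i} {σ}
        (≡.subst₂ ℕ._≤_ (≡.sym (Relaxing.one≡ inv)) (≡.sym (Relaxing.i≡ inv)) (s≤s z≤n)) , runs-relaxStep inv)
      (λ {σ} inv → test-≰ᴺ {one} {i} {σ} λ 1≤0 →
        ℕₚ.1+n≰n (≡.subst₂ ℕ._≤_ (Relaxing.one≡ inv) (Relaxing.i≡ inv) 1≤0))
      k

    -- The moment just before `inc j`: the tables already account for sensor `j`, while the loop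
    -- counter does not.
    Extended : ℕ → State → Set (c ⊔ ℓ₁ ⊔ ℓ₂)
    Extended todo σ = InFrame (suc todo) σ ×
      Table (reals σ 0) (reals σ 1) (reals σ 3) (reals σ 5 0) (suc (regs σ 1))

    runs-finish : ∀ {todo σ} → Relaxing todo 0 σ → Runs finish σ 11 (Extended todo)
    runs-finish {σ = σ} inv =
      tt ⨟ tt ⨟ tt ⨟ tt ⨟ <⇒≉0 0<bj ⨟ runs-maxOf ≫= λ
        { (w , isMax , ≡.refl) →
          tt ⨟ <⇒≉0 (0<exit σxs σbs 0<bj reach isMax) ⨟ runs-map
            (λ { (t , isMax′ , ≡.refl) → inFrame , record
              { reachBound = update-≺ (λ k a → 0# < σbs k → ∀ {r} → (a ≤ r) ⇔ Reach σxs σbs r k)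
                  reachBound (λ _ → reach)
              ; bestRate = bestRate-step σxs σbs 0<bj reach isMax isMax′ bestRate } })
            runs-maxOf }
      where
      open Relaxing inv
      σxs σbs : ℕ → Carrier
      σxs = reals σ 0
      σbs = reals σ 1
      reach : ∀ {r} → (reals σ 7 0 ≤ r) ⇔ Reach σxs σbs r (regs σ 1)
      reach = reachFrom-0 σxs σbs 0<bj bound

    runs-stage : ∀ {todo σ} → Staged (suc todo) σ → Runs stage σ (stageTime n) (Staged todo)
    runs-stage {todo} {σ} (inFrame , tabulated) =
      tt ⨟ tt ⨟ runs-if
        (λ bj≤0 → runs-skip {Q = Extended todo} (inFrame , record
          { reachBound = λ k<1+j → [ reachBound , (λ { ≡.refl 0<bj → contradiction bj≤0 (<⇒≱ 0<bj) }) ]′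
              (ℕₚ.m<1+n⇒m<n∨m≡n k<1+j)
          ; bestRate = bestRate-skip σxs σbs bj≤0 bestRate }))
        (λ bj≰0 → <⇒≉0 (≰⇒> bj≰0) ⨟ tt ⨟ tt ⨟
          -- The inner loop runs `j` times; `j < n` replaces its cost by one common to all stages.
          weaken-time (s≤s (ℕₚ.*-monoˡ-≤ 12 (ℕₚ.<⇒≤ (j<n inFrame)))) (runs-relaxLoop record
            { inFrame = inFrame ; tabulated = tabulated ; 0<bj = ≰⇒> bj≰0 ; one≡ = ≡.refl ; i≡ = ≡.refl
            ; k≤j = ℕₚ.≤-refl ; bound = reachFrom-init σxs σbs (≰⇒> bj≰0) })
          ≫= runs-finish)
      ≫= λ (frame , extended) → runs-instr tt (advance frame , extended)
      where
      open Table tabulated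
      σxs σbs : ℕ → Carrier
      σxs = reals σ 0
      σbs = reals σ 1

    runs-emit : ∀ {todo σ} → Emitting (suc todo) σ → Runs emit σ 5 (Emitting todo)
    runs-emit {todo} {σ} (inFrame , emission) =
      tt ⨟ tt ⨟ runs-if {Q = Emitted}
        (λ τ≤0 → runs-instr tt (inFrame , extend (dead τ≤0 ≡.refl)))
        (λ τ≰0 → runs-instr (<⇒≉0 (≰⇒> τ≰0)) (inFrame , extend (alive τ≰0 ≡.refl)))
      ≫= λ (frame , emitted) → runs-instr tt (advance frame , emitted)
      where
      open Emission emission
      Emitted : State → Set (c ⊔ ℓ₁ ⊔ ℓ₂)
      Emitted σ = InFrame (suc todo) σ × Emission (reals σ 0) (reals σ 1) (reals σ 2) (reals σ 5 0) (suc (regs σ 1))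
      extend : ∀ {ρ} → IsRadius (reals σ 5 0) (reals σ 1 (regs σ 1)) ρ →
               Emission (reals σ 0) (reals σ 1) (update (regs σ 1) ρ (reals σ 2)) (reals σ 5 0) (suc (regs σ 1))
      extend radius = record
        { bestRate = bestRate
        ; radii    = update-≺ (λ k → IsRadius (reals σ 5 0) (reals σ 1 k)) radii radius }

  runs-solver : ∀ {n} .{{_ : ℕ.NonZero n}} (I : Instance n) → let open Instance I in
                Runs solver (input I) (solverTime n) (Emitting n (padded x) (padded b) 0)
  runs-solver {n} I =
    tt ⨟
    runs-while (Staged n X B)
      (λ {_} {σ} (frame , table) → continue n X B {σ = σ} frame , runs-stage n X B (frame , table))
      (λ {σ} (frame , _) → exit n X B {σ} frame)
      n
      (record { xs≡ = ≡.refl ; bs≡ = ≡.refl ; last≡ = ℕₚ.suc-pred n ; remaining = ≡.sym (ℕₚ.suc-pred n) } ,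
       record { reachBound = λ () ; bestRate = bestRate-zero X B })
    ≫= λ {σ} (frame , table) →
    tt ⨟
    runs-while (Emitting n X B)
      (λ {_} {σ} (frame , emission) → continue n X B {σ = σ} frame , runs-emit n X B (frame , emission))
      (λ {σ} (frame , _) → exit n X B {σ} frame)
      n
      (record { xs≡ = Frame.xs≡ frame ; bs≡ = Frame.bs≡ frame ; last≡ = Frame.last≡ frame
              ; remaining = ≡.sym (Frame.last≡ frame) } ,
       -- The first loop ends with `j ≡ n`, so `τ` now accounts for all sensors.
       record { bestRate = ≡.subst (IsBestRate _ _ _) (j≡n n X B frame) (Table.bestRate table) ; radii = λ () })
    where
    X B : ℕ → Carrier
    X = padded (Instance.x I)
    B = padded (Instance.b I)

  emitted⇒optimal : ∀ {n} .{{_ : ℕ.NonZero n}} (I : Instance n) {σ} → let open Instance I in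
                    Emitting n (padded x) (padded b) 0 σ → IsOptimal I (output σ)
  emitted⇒optimal {n} I {σ} (frame , emission) =
    IsRadius⇒IsOptimal I (≡.subst₂ (λ X B → IsBestRate X B (reals σ 5 0) n) xs≡ bs≡ bestRate) λ k →
      ≡.subst (λ b → IsRadius (reals σ 5 0) b (reals σ 2 (toℕ k)))
        (≡.trans (≡.cong (_$ toℕ k) bs≡) (padded-toℕ b k))
        (radii (≡.subst (toℕ k ℕ.<_) (≡.sym (j≡n n _ _ frame)) (toℕ<n k)))
    where
    open Instance I
    open Frame frame
    open Emission emission

-- The quadratic time bound and the theorem.

open import Data.Nat using (_*_; _^_)

-- Since `n` is at least 1, constants and linear terms are absorbed into `n ^ 2`; 42 is 1 + 1 + 32 +
-- 2 + 6, where 32 is the sum 8 + 12 + 12 coming from `stageTime`.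
solverTime≤42n² : ∀ n .{{_ : ℕ.NonZero n}} → solverTime n ℕ.≤ 42 * n ^ 2
solverTime≤42n² n = begin
  1 ℕ.+ (1 ℕ.+ n * suc (stageTime n) ℕ.+ (2 ℕ.+ n * 6))
    ≤⟨ ℕₚ.+-mono-≤ (k≤kn² 1) (ℕₚ.+-mono-≤ (ℕₚ.+-mono-≤ (k≤kn² 1) n*stage≤) (ℕₚ.+-mono-≤ (k≤kn² 2) n*6≤)) ⟩
  1 * n ^ 2 ℕ.+ (1 * n ^ 2 ℕ.+ 32 * n ^ 2 ℕ.+ (2 * n ^ 2 ℕ.+ 6 * n ^ 2))
    ≡⟨ ≡.cong (1 * n ^ 2 ℕ.+_) (≡.cong₂ ℕ._+_ (ℕₚ.*-distribʳ-+ (n ^ 2) 1 32) (ℕₚ.*-distribʳ-+ (n ^ 2) 2 6)) ⟨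
  1 * n ^ 2 ℕ.+ (33 * n ^ 2 ℕ.+ 8 * n ^ 2)
    ≡⟨ ≡.cong (1 * n ^ 2 ℕ.+_) (ℕₚ.*-distribʳ-+ (n ^ 2) 33 8) ⟨
  1 * n ^ 2 ℕ.+ 41 * n ^ 2
    ≡⟨ ℕₚ.*-distribʳ-+ (n ^ 2) 1 41 ⟨
  42 * n ^ 2 ∎
  where
  open ℕₚ.≤-Reasoning
  n²≡n*n : n ^ 2 ≡ n * n
  n²≡n*n = ≡.cong (n *_) (ℕₚ.*-identityʳ n)
  k≤kn² : ∀ k → k ℕ.≤ k * n ^ 2
  k≤kn² k = ℕₚ.m≤m*n k (n ^ 2) {{ℕₚ.m^n≢0 n 2}}
  n*6≤ : n * 6 ℕ.≤ 6 * n ^ 2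
  n*6≤ = begin
    n * 6        ≡⟨ ℕₚ.*-comm n 6 ⟩
    6 * n        ≤⟨ ℕₚ.*-monoʳ-≤ 6 (ℕₚ.m≤m*n n n) ⟩
    6 * (n * n)  ≡⟨ ≡.cong (6 *_) n²≡n*n ⟨
    6 * n ^ 2    ∎
  stage≤ : suc (stageTime n) ℕ.≤ 32 * n
  stage≤ = begin
    8 ℕ.+ (n * 12 ℕ.+ 11 ℕ.+ 1)       ≡⟨ ≡.cong (8 ℕ.+_) (ℕₚ.+-assoc (n * 12) 11 1) ⟩
    8 ℕ.+ (n * 12 ℕ.+ 12)             ≤⟨ ℕₚ.+-mono-≤ (ℕₚ.m≤m*n 8 n)
                                           (ℕₚ.+-mono-≤ (ℕₚ.≤-reflexive (ℕₚ.*-comm n 12)) (ℕₚ.m≤m*n 12 n)) ⟩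
    8 * n ℕ.+ (12 * n ℕ.+ 12 * n)     ≡⟨ ≡.cong (8 * n ℕ.+_) (ℕₚ.*-distribʳ-+ n 12 12) ⟨
    8 * n ℕ.+ 24 * n                  ≡⟨ ℕₚ.*-distribʳ-+ n 8 24 ⟨
    32 * n                            ∎
  n*stage≤ : n * suc (stageTime n) ℕ.≤ 32 * n ^ 2
  n*stage≤ = begin
    n * suc (stageTime n)  ≤⟨ ℕₚ.*-monoʳ-≤ n stage≤ ⟩
    n * (32 * n)  ≡⟨ ℕₚ.*-comm n (32 * n) ⟩
    32 * n * n    ≡⟨ ℕₚ.*-assoc 32 n n ⟩
    32 * (n * n)  ≡⟨ ≡.cong (32 *_) n²≡n*n ⟨
    32 * n ^ 2    ∎

-- The threshold is 2 because `⌊log₂ n ⌋` vanishes at 1 and is at least 1 from 2 on.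
42n²∈O : (λ n → 42 * n ^ 2) ∈O (λ n → n ^ 2 * ⌊log₂ n ⌋)
42n²∈O = 42 , 2 , λ n 2≤n →
  ℕₚ.*-monoʳ-≤ 42 (ℕₚ.m≤m*n (n ^ 2) ⌊log₂ n ⌋ {{ℕ.>-nonZero (⌊log₂⌋-mono-≤ 2≤n)}})

theorem4 : ∀ {c ℓ₁ ℓ₂ : Level} (F : OrderedField c ℓ₁ ℓ₂) →
    let open RadSCAlgorithm F in
    ∃₂ λ P T → SolvesRadSCWithin P T × T ∈O (λ n → n ^ 2 * ⌊log₂ n ⌋)
theorem4 F = solver , (λ n → 42 * n ^ 2) , solves , 42n²∈O
  where
  open Solver F
  open ProgramLogic F
  open RadSCAlgorithm F
  solves : SolvesRadSCWithin solver λ n → 42 * n ^ 2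
  solves n I = σ′ , t , run , emitted⇒optimal I {σ′} post , ℕₚ.≤-trans t≤C (solverTime≤42n² n)
    where open Runs (runs-solver I)
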